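{- Let $\mathcal C$ be a Markov category with enough states. Let $M$ be an open deterministic causal model in $\mathcal C$ over variables $V$ with $V^{\rm out}=V^{\rm nin}$, each of whose variables has at least one state in $\mathcal C$, with a set of interventions $\mathcal I$ containing the trivial intervention. Let $W$ be a further finite set of variables, with given objects of $\mathcal C$, input subset $W^{\rm in}$ and output subset $W^{\rm out}=W^{\rm nin}$, and suppose that $\rho\colon V\to W$ is a deterministic isomorphism which respects $(\mathcal I,M)$. Then $$(\rho,\hat\rho)\colon(\mathcal I^{\mathsf{io}},M)\to(\hat\rho(\mathcal I)^{\mathsf{io}},\rho(M))$$ defines a (bijective) upward abstraction. Explicitly, for all $\sigma\in\mathcal I$ we have $$\rho^{\rm nin}\circ(M_\sigma)^{\mathrm{io}}=\big(\rho(M)_{\hat\rho(\sigma)}\big)^{\mathrm{io}}\circ\rho^{\rm in}.$$ In particular $\rho^{\rm nin}\circ M^{\mathrm{io}}=\rho(M)^{\mathrm{io}}\circ\rho^{\rm in}$.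
   Context: **Categories.** A Markov category is a symmetric monoidal category with terminal unit $I$ in which each object has a commutative comonoid structure (copy, discard) compatible with $\otimes$. Morphisms are called channels; $f$ is deterministic if $\mathrm{copy}\circ f=(f\otimes f)\circ\mathrm{copy}$; a sharp state of $A$ is a deterministic morphism $I\to A$. $\mathcal C$ has enough states if $f\circ x=g\circ x$ for all sharp states $x$ implies $f=g$. **Causal models.** An open DAG is a finite DAG with vertex set $V$ and a subset $V^{\rm in}\subseteq V$ of parentless vertices (inputs); $V^{\rm nin}=V\setminus V^{\rm in}$. A causal model $M$ over it in $\mathcal C$ consists of an object of $\mathcal C$ (again written $X$) for each vertex $X$, a channel (mechanism) $c_X\colon\bigotimes_{Y\in\mathrm{Pa}(X)}Y\to X$ for each $X\in V^{\rm nin}$, and outputs $V^{\rm out}\subseteq V$; here always $V^{\rm out}=V^{\rm nin}$. It is deterministic if all $c_X$ are. A set of variables also denotes the tensor of the corresponding objects. $M^{\mathrm{io}}\colon V^{\rm in}\to V^{\rm out}$ is the channel obtained by wiring together all mechanisms with copy maps, copying each output variable once more to form an output (and discarding unused inputs). An intervention $\sigma$ on $M$ specifies new mechanisms $c'_X$ (possibly with new parents, but introducing no directed cycles) for a subset of variables $X\in V^{\rm nin}$, yielding a causal model $M_\sigma$ with the same variables, objects, inputs and outputs; here all $M_\sigma$ are deterministic. The trivial intervention changes nothing. **Parallel mechanism channel.** For $V=\{X_1,\dots,X_n\}$, $F_M\colon V\to V$ is the deterministic channel with $F_M=(F_{X_1}\otimes\dots\otimes F_{X_n})\circ\mathrm{copy}_V^{(n)}$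 (with $\mathrm{copy}_V^{(n)}\colon V\to V^{\otimes n}$ the $n$-fold copy), where for a non-input $X$, $F_X\colon V\to X$ is $c_X$ applied to $\mathrm{Pa}(X)$ with all other variables discarded, and for an input $X$, $F_X\colon V\to X$ is the projection $\mathrm{id}_X\otimes\mathrm{disc}$. **Model from a channel.** Conversely, for a deterministic channel $F\colon V\to V$ with marginals $F_X\colon V\to X$, declare $X$ an input if $F_X=\mathrm{id}_X\otimes\mathrm{disc}$; otherwise let $\mathrm{Pa}(X)$ be the least subset of variables, and $c_X\colon\mathrm{Pa}(X)\to X$ the corresponding channel, such that $F_X=c_X\otimes\mathrm{disc}$ (such a least subset exists). $F$ is acyclic if these parent sets define an acyclic directed graph; then $\mathsf M[F]$ denotes the resulting causal model with mechanisms $c_X$ (outputs being the non-inputs). **Induction.** A deterministic isomorphism $\rho\colon V\to W$ (meaning between the tensor products of all variables) respects $M$ if the channel $\rho\circ F_M\circ\rho^{ -1}\colon W\to W$ is acyclic, with set of inputs exactly $W^{\rm in}$, and $\rho=\rho^{\rm in}\otimes\rho^{\rm nin}$ for isomorphisms $\rho^{\rm in}\colon V^{\rm in}\to W^{\rm in}$, $\rho^{\rm nin}\colon V^{\rm nin}\to W^{\rm nin}$. The induced model is then $\rho(M):=\mathsf M[\rho\circ F_M\circ\rho^{ -1}]$. $\rho$ respects $(\mathcal I,M)$ if it respects $M_\sigma$ for each $\sigma\in\mathcal I$; in that case, for each $\sigma\in\mathcal I$, the induced intervention $\hat\rho(\sigma)$ on $\rho(M)$ is defined via $\rho(M)_{\hat\rho(\sigma)}:=\rho(M_\sigma)$,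 and $\hat\rho(\mathcal I)$ denotes the set of such interventions on $\rho(M)$. **Upward abstraction.** For a set $\mathcal I$ of interventions on a model $M$, $\mathcal I^{\mathsf{io}}$ is the query signature with two types $\mathsf{in},\mathsf{out}$ and a query $\sigma\colon\mathsf{in}\to\mathsf{out}$ for each $\sigma\in\mathcal I$, modelled by $[\![\mathsf{in}]\!]=V^{\rm in}$, $[\![\mathsf{out}]\!]=V^{\rm out}$, $[\![\sigma]\!]=M_\sigma^{\mathrm{io}}$. An upward abstraction $(\tau,\omega)\colon(\mathcal I_L^{\mathsf{io}},L)\to(\mathcal I_H^{\mathsf{io}},H)$ consists of epic deterministic channels $\tau^{\rm in}\colon V_L^{\rm in}\to V_H^{\rm in}$, $\tau^{\rm out}\colon V_L^{\rm out}\to V_H^{\rm out}$ (with epic tensor products) and a partial surjective map $\omega$ from $\mathcal I_L$ to $\mathcal I_H$ with $\tau^{\rm out}\circ L_\sigma^{\mathrm{io}}=H_{\omega(\sigma)}^{\mathrm{io}}\circ\tau^{\rm in}$ whenever $\omega(\sigma)$ is defined. In the claim, $\tau^{\rm in}=\rho^{\rm in}$, $\tau^{\rm out}=\rho^{\rm nin}$, $\omega=\hat\rho$; "bijective" refers to the map $\omega=\hat\rho\colon\mathcal I\to\hat\rho(\mathcal I)$.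
   Formalization: For "bijective", interventions are identified when the resulting models have the same parallel mechanism channel F; read literally it fails, since interventions differing only by a parent the mechanism discards, or restating a mechanism unchanged, have the same image. -}

module Defs where

open import Level using (Level; _⊔_; suc; 0ℓ)
open import Data.Nat.Base using (ℕ)
open import Data.Fin.Base using (Fin)
open import Data.Fin.Properties using (_≟_)
open import Data.Fin.Induction using (spo-wellFounded)
open import Data.Fin.Subset using (Subset; _∈_; _⊆_; ∁)
open import Data.Fin.Subset.Properties using (_∈?_; x∉p⇒x∈∁p)
open import Data.List.Base using (List; []; _∷_; allFin; filter)
open import Data.List.Relation.Unary.Any using (here; there)
open import Data.List.Membership.Propositional using () renaming (_∈_ to _∈ˡ_; _∉_ to _∉ˡ_)
open import Data.List.Membership.Propositional.Properties using (∈-allFin; ∈-filter⁺; ∈-filter⁻)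
import Data.List.Membership.DecPropositional as DecMembership
open import Data.List.Relation.Binary.Subset.Propositional using () renaming (_⊆_ to _⊆ˡ_)
open import Data.Maybe.Base using (Maybe; just; nothing; maybe′)
open import Data.Product.Base using (Σ; Σ-syntax; ∃; _×_; _,_; proj₁; proj₂)
open import Function.Base using (id; _∘′_)
open import Function.Bundles using (_⇔_)
open import Induction.WellFounded using (WellFounded; Acc; acc)
open import Relation.Binary.Bundles using (Setoid)
open import Relation.Binary.Core using (Rel)
open import Relation.Binary.Definitions using (_Respects_)
open import Relation.Binary.PropositionalEquality using (_≡_; refl; isEquivalence; resp₂)
open import Relation.Binary.Structures using (IsEquivalence)
open import Relation.Binary.Construct.Closure.Transitive using (TransClosure; [_]; transitive)
import Relation.Binary.Construct.On as On
open import Relation.Nullary using (¬_; yes; no; contradiction)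
open import Relation.Unary using (Pred)

data IOType : Set where
  inᵗ outᵗ : IOType

record Category (o ℓ e : Level) : Set (suc (o ⊔ ℓ ⊔ e)) where
  infix  4 _≈_ _⇒_
  infixr 9 _∘_
  field
    Obj   : Set o
    _⇒_   : Rel Obj ℓ
    _≈_   : ∀ {A B} → Rel (A ⇒ B) e
    equiv : ∀ {A B} → IsEquivalence (_≈_ {A} {B})
    idₘ   : ∀ {A} → A ⇒ A
    _∘_   : ∀ {A B C} → B ⇒ C → A ⇒ B → A ⇒ C

    ∘-cong    : ∀ {A B C} {f f′ : B ⇒ C} {g g′ : A ⇒ B} →
                f ≈ f′ → g ≈ g′ → f ∘ g ≈ f′ ∘ g′
    ∘-assoc   : ∀ {A B C D} {f : C ⇒ D} {g : B ⇒ C} {h : A ⇒ B} →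
                (f ∘ g) ∘ h ≈ f ∘ (g ∘ h)
    identityˡ : ∀ {A B} {f : A ⇒ B} → idₘ ∘ f ≈ f
    identityʳ : ∀ {A B} {f : A ⇒ B} → f ∘ idₘ ≈ f

  homSetoid : Obj → Obj → Setoid ℓ e
  homSetoid A B = record { Carrier = A ⇒ B ; _≈_ = _≈_ ; isEquivalence = equiv }

  Epic : ∀ {A B} → A ⇒ B → Set (o ⊔ ℓ ⊔ e)
  Epic {B = B} f = ∀ {C} (g h : B ⇒ C) → g ∘ f ≈ h ∘ f → g ≈ h

  record Iso (A B : Obj) : Set (ℓ ⊔ e) where
    field
      to   : A ⇒ B
      from : B ⇒ A
      to∘from≈id : to ∘ from ≈ idₘ
      from∘to≈id : from ∘ to ≈ idₘ

record SymmetricMonoidalCategory (o ℓ e : Level) : Set (suc (o ⊔ ℓ ⊔ e)) where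
  field
    category : Category o ℓ e
  open Category category public

  infixr 10 _⊗₀_ _⊗₁_
  field
    unit : Obj
    _⊗₀_ : Obj → Obj → Obj
    _⊗₁_ : ∀ {A B C D} → A ⇒ C → B ⇒ D → A ⊗₀ B ⇒ C ⊗₀ D

    ⊗-cong     : ∀ {A B C D} {f f′ : A ⇒ C} {g g′ : B ⇒ D} →
                 f ≈ f′ → g ≈ g′ → f ⊗₁ g ≈ f′ ⊗₁ g′
    ⊗-identity : ∀ {A B} → idₘ {A} ⊗₁ idₘ {B} ≈ idₘ
    ⊗-∘        : ∀ {A B C A′ B′ C′} {g : B ⇒ C} {f : A ⇒ B} {g′ : B′ ⇒ C′} {f′ : A′ ⇒ B′} →
                 (g ∘ f) ⊗₁ (g′ ∘ f′) ≈ (g ⊗₁ g′) ∘ (f ⊗₁ f′)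

    assoc    : ∀ {A B C} → Iso ((A ⊗₀ B) ⊗₀ C) (A ⊗₀ (B ⊗₀ C))
    unitorˡ  : ∀ {A} → Iso (unit ⊗₀ A) A
    unitorʳ  : ∀ {A} → Iso (A ⊗₀ unit) A
    braiding : ∀ {A B} → A ⊗₀ B ⇒ B ⊗₀ A

  module assoc    {A} {B} {C} = Iso (assoc {A} {B} {C})
  module unitorˡ {A} = Iso (unitorˡ {A})
  module unitorʳ {A} = Iso (unitorʳ {A})

  field
    assoc-natural    : ∀ {A B C A′ B′ C′} {f : A ⇒ A′} {g : B ⇒ B′} {h : C ⇒ C′} →
                       assoc.to ∘ ((f ⊗₁ g) ⊗₁ h) ≈ (f ⊗₁ (g ⊗₁ h)) ∘ assoc.to
    unitorˡ-natural  : ∀ {A B} {f : A ⇒ B} → unitorˡ.to ∘ (idₘ ⊗₁ f) ≈ f ∘ unitorˡ.to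
    unitorʳ-natural  : ∀ {A B} {f : A ⇒ B} → unitorʳ.to ∘ (f ⊗₁ idₘ) ≈ f ∘ unitorʳ.to
    braiding-natural : ∀ {A B C D} {f : A ⇒ C} {g : B ⇒ D} →
                       braiding ∘ (f ⊗₁ g) ≈ (g ⊗₁ f) ∘ braiding

    triangle : ∀ {A B} →
               (idₘ ⊗₁ unitorˡ.to) ∘ assoc.to ≈ unitorʳ.to {A} ⊗₁ idₘ {B}
    pentagon : ∀ {A B C D} →
               (idₘ {A} ⊗₁ assoc.to {B} {C} {D}) ∘ assoc.to ∘ (assoc.to ⊗₁ idₘ)
               ≈ assoc.to ∘ assoc.to
    hexagon  : ∀ {A B C} →
               (idₘ ⊗₁ braiding) ∘ assoc.to ∘ (braiding ⊗₁ idₘ)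
               ≈ assoc.to ∘ braiding ∘ assoc.to {A} {B} {C}
    symmetry : ∀ {A B} → braiding ∘ braiding {A} {B} ≈ idₘ

  middleSwap : ∀ {A B C D} → (A ⊗₀ B) ⊗₀ (C ⊗₀ D) ⇒ (A ⊗₀ C) ⊗₀ (B ⊗₀ D)
  middleSwap = assoc.from
             ∘ (idₘ ⊗₁ (assoc.to ∘ (braiding ⊗₁ idₘ) ∘ assoc.from))
             ∘ assoc.to

-- Terminality of the unit makes discarding natural, and makes it and copying
-- automatically compatible with the unit, respectively discarding with ⊗.
record MarkovCategory (o ℓ e : Level) : Set (suc (o ⊔ ℓ ⊔ e)) where
  field
    symmetricMonoidal : SymmetricMonoidalCategory o ℓ e
  open SymmetricMonoidalCategory symmetricMonoidal public

  field
    disc        : ∀ {A} → A ⇒ unit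
    disc-unique : ∀ {A} (f : A ⇒ unit) → f ≈ disc

    copy             : ∀ {A} → A ⇒ A ⊗₀ A
    copy-coassoc     : ∀ {A} → assoc.to ∘ (copy ⊗₁ idₘ) ∘ copy ≈ (idₘ ⊗₁ copy) ∘ copy {A}
    copy-counitˡ     : ∀ {A} → unitorˡ.to ∘ (disc ⊗₁ idₘ) ∘ copy ≈ idₘ {A}
    copy-counitʳ     : ∀ {A} → unitorʳ.to ∘ (idₘ ⊗₁ disc) ∘ copy ≈ idₘ {A}
    copy-cocommute   : ∀ {A} → braiding ∘ copy ≈ copy {A}
    copy-⊗           : ∀ {A B} → copy {A ⊗₀ B} ≈ middleSwap ∘ (copy ⊗₁ copy)

  Deterministic : ∀ {A B} → A ⇒ B → Set e
  Deterministic f = copy ∘ f ≈ (f ⊗₁ f) ∘ copy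

  State : Obj → Set ℓ
  State A = unit ⇒ A

  HasEnoughStates : Set (o ⊔ ℓ ⊔ e)
  HasEnoughStates = ∀ {A B} (f g : A ⇒ B) →
    (∀ (x : State A) → Deterministic x → f ∘ x ≈ g ∘ x) → f ≈ g

  record DeterministicIso (A B : Obj) : Set (ℓ ⊔ e) where
    field
      iso : Iso A B
    open Iso iso public
    field
      deterministic : Deterministic to

  -- Tensor products of finite families, over a list of indices.
  module _ {k} {K : Set k} where

    ⨂₀ : (K → Obj) → List K → Obj
    ⨂₀ A []       = unit
    ⨂₀ A (i ∷ is) = A i ⊗₀ ⨂₀ A is

    ⨂₁ : {A B : K → Obj} → (∀ i → A i ⇒ B i) → ∀ is → ⨂₀ A is ⇒ ⨂₀ B is
    ⨂₁ f []       = idₘ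
    ⨂₁ f (i ∷ is) = f i ⊗₁ ⨂₁ f is

    module _ (A : K → Obj) where

      -- The marginal at one factor: identity there, discarding elsewhere.
      proj : ∀ {i is} → i ∈ˡ is → ⨂₀ A is ⇒ A i
      proj (here refl) = unitorʳ.to ∘ (idₘ ⊗₁ disc)
      proj (there i∈)  = unitorˡ.to ∘ (disc ⊗₁ proj i∈)

      -- (⨂ᵢ fᵢ) ∘ copy⁽ⁿ⁾, the n-fold copy being iterated binary copying.
      tuple : ∀ {C} is → (∀ {i} → i ∈ˡ is → C ⇒ A i) → C ⇒ ⨂₀ A is
      tuple []       f = disc
      tuple (i ∷ is) f = (f (here refl) ⊗₁ tuple is (f ∘′ there)) ∘ copy

      -- Permuting, copying and discarding wires.  When js has no repetitions,
      -- this keeps the wires in js and discards all others.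
      rewire : ∀ is js → js ⊆ˡ is → ⨂₀ A is ⇒ ⨂₀ A js
      rewire is js js⊆is = tuple js (λ j∈js → proj (js⊆is j∈js))

elements : ∀ {n} → Subset n → List (Fin n)
elements {n} S = filter (_∈? S) (allFin n)

∈-elements⁺ : ∀ {n} {S : Subset n} {X : Fin n} → X ∈ S → X ∈ˡ elements S
∈-elements⁺ {S = S} {X} = ∈-filter⁺ (_∈? S) (∈-allFin X)

∈-elements⁻ : ∀ {n} {S : Subset n} {X : Fin n} → X ∈ˡ elements S → X ∈ S
∈-elements⁻ {n} {S} X∈ = proj₂ (∈-filter⁻ (_∈? S) {xs = allFin n} X∈)

Acyclic : ∀ {n} → Rel (Fin n) 0ℓ → Set
Acyclic _⟶_ = ∀ X → ¬ TransClosure _⟶_ X X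

module CausalModels {o ℓ e : Level} (𝒞 : MarkovCategory o ℓ e) where
  open MarkovCategory 𝒞

  -- The outputs are always taken to be the non-inputs.
  record Variables : Set o where
    field
      size   : ℕ
      ob     : Fin size → Obj
      inputs : Subset size

    Var : Set
    Var = Fin size

    nonInputs : Subset size
    nonInputs = ∁ inputs

    ⟦_⟧ : Subset size → Obj
    ⟦ S ⟧ = ⨂₀ ob (elements S)

    ⟦all⟧ ⟦in⟧ ⟦nin⟧ : Obj
    ⟦all⟧ = ⨂₀ ob (allFin size)
    ⟦in⟧  = ⟦ inputs ⟧
    ⟦nin⟧ = ⟦ nonInputs ⟧

    ⟦_⟧ᵗ : IOType → Obj
    ⟦ inᵗ  ⟧ᵗ = ⟦in⟧
    ⟦ outᵗ ⟧ᵗ = ⟦nin⟧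

    π : (X : Var) → ⟦all⟧ ⇒ ob X
    π X = proj ob (∈-allFin X)

    restrict : (S : Subset size) → ⟦all⟧ ⇒ ⟦ S ⟧
    restrict S = rewire ob (allFin size) (elements S) (λ {X} _ → ∈-allFin X)

    -- The canonical (shuffle) isomorphism V ≅ Vⁱⁿ ⊗ Vⁿⁱⁿ.
    split : ⟦all⟧ ⇒ ⟦in⟧ ⊗₀ ⟦nin⟧
    split = (restrict inputs ⊗₁ restrict nonInputs) ∘ copy

  module _ (V : Variables) where
    open Variables V

    -- Only non-inputs are given parents, so inputs are parentless.
    Parents : Set
    Parents = ∀ X → X ∈ nonInputs → Subset size

    data Edge (Pa : Parents) (Y X : Var) : Set where
      edge : (p : X ∈ nonInputs) → Y ∈ Pa X p → Edge Pa Y X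

    record Model : Set ℓ where
      field
        Pa      : Parents
        channel : ∀ X (p : X ∈ nonInputs) → ⟦ Pa X p ⟧ ⇒ ob X
        acyclic : Acyclic (Edge Pa)

  module _ {V : Variables} where
    open Variables V
    private module L = DecMembership (_≟_ {size})

    DeterministicModel : Model V → Set e
    DeterministicModel M = ∀ X p → Deterministic (channel X p)
      where open Model M

    module _ (M : Model V) where
      open Model M

      -- Enumerations, latest first, of ancestrally closed sets of variables
      -- containing all inputs.
      data Ordering : List Var → Set where
        start  : Ordering (elements inputs)
        extend : ∀ {Xs X} (p : X ∈ nonInputs) → X ∉ˡ Xs → elements (Pa X p) ⊆ˡ Xs →
                 Ordering Xs → Ordering (X ∷ Xs)

      wire : ∀ {Xs} → Ordering Xs → ⟦in⟧ ⇒ ⨂₀ ob Xs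
      wire start                        = idₘ
      wire (extend {Xs} {X} p _ Pa⊆Xs o) =
        ((channel X p ∘ rewire ob Xs (elements (Pa X p)) Pa⊆Xs) ⊗₁ idₘ) ∘ copy ∘ wire o

      private
        ancestor-wf : WellFounded (TransClosure (Edge V Pa))
        ancestor-wf = spo-wellFounded {_≈_ = _≡_} record
          { isEquivalence = isEquivalence
          ; irrefl        = λ { {X} refl → acyclic X }
          ; trans         = transitive _
          ; <-resp-≈      = resp₂ _
          }

        inputs⊆ : ∀ {Xs X} → Ordering Xs → X ∈ inputs → X ∈ˡ Xs
        inputs⊆ start            X∈ = ∈-elements⁺ X∈
        inputs⊆ (extend _ _ _ o) X∈ = there (inputs⊆ o X∈)

        Grow : List Var → Set
        Grow Ys = ∀ {Xs} → Ordering Xs → ∃ λ Zs → Ordering Zs × Xs ⊆ˡ Zs × Ys ⊆ˡ Zs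

        growAll : ∀ Ys → (∀ {Y} → Y ∈ˡ Ys → Grow (Y ∷ [])) → Grow Ys
        growAll []       g o = _ , o , id , λ ()
        growAll (Y ∷ Ys) g o with growAll Ys (g ∘′ there) o
        ... | _ , o₁ , ⊆₁ , Ys⊆₁ with g (here refl) o₁
        ...   | _ , o₂ , ⊆₂ , Y∈₂ =
          _ , o₂ , ⊆₂ ∘′ ⊆₁ , λ { (here refl) → Y∈₂ (here refl) ; (there Z∈) → ⊆₂ (Ys⊆₁ Z∈) }

        grow : ∀ X → Acc (TransClosure (Edge V Pa)) X → Grow (X ∷ [])
        grow X (acc rs) {Xs} o with X ∈? inputs
        ... | yes X∈in = _ , o , id , λ { (here refl) → inputs⊆ o X∈in }
        ... | no  X∉in with x∉p⇒x∈∁p X∉in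
        ...   | p with growAll (elements (Pa X p))
                         (λ Y∈ → grow _ (rs [ edge p (∈-elements⁻ Y∈) ])) o
        ...     | Zs , o₁ , Xs⊆ , Pa⊆ with X L.∈? Zs
        ...       | yes X∈ = _ , o₁ , Xs⊆ , λ { (here refl) → X∈ }
        ...       | no  X∉ = _ , extend p X∉ Pa⊆ o₁ , there ∘′ Xs⊆ , λ { (here refl) → here refl }

      topologicalOrder : ∃ λ Xs → Ordering Xs × allFin size ⊆ˡ Xs
      topologicalOrder with growAll (allFin size) (λ {X} _ → grow X (ancestor-wf X)) start
      ... | Xs , o , _ , all⊆ = Xs , o , all⊆

      -- Wires up all mechanisms in topological order, keeping a copy of every
      -- variable, and finally discards the inputs.
      ioAlong : ∀ {Xs} → Ordering Xs → allFin size ⊆ˡ Xs → ⟦in⟧ ⇒ ⟦nin⟧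
      ioAlong {Xs} o all⊆ =
        rewire ob Xs (elements nonInputs) (λ {X} _ → all⊆ (∈-allFin X)) ∘ wire o

      io : ⟦in⟧ ⇒ ⟦nin⟧
      io = let _ , o , all⊆ = topologicalOrder in ioAlong o all⊆

      component : (X : Var) → ⟦all⟧ ⇒ ob X
      component X with X ∈? inputs
      ... | yes _    = π X
      ... | no  X∉in = channel X p ∘ restrict (Pa X p)
        where p = x∉p⇒x∈∁p X∉in

      parallel : ⟦all⟧ ⇒ ⟦all⟧
      parallel = tuple ob (allFin size) (λ {X} _ → component X)

    -- A channel f out of V depends only on P, via the channel c.
    record LeastFactorisation {A : Obj} (f : ⟦all⟧ ⇒ A) : Set (ℓ ⊔ e) where
      field
        P      : Subset size
        c      : ⟦ P ⟧ ⇒ A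
        factor : f ≈ c ∘ restrict P
        least  : ∀ Q (d : ⟦ Q ⟧ ⇒ A) → f ≈ d ∘ restrict Q → P ⊆ Q

    -- F is acyclic and its set of inputs is exactly that of V.  The least
    -- parent sets exist classically; constructively they are part of the data.
    record AcyclicChannel (F : ⟦all⟧ ⇒ ⟦all⟧) : Set (ℓ ⊔ e) where
      field
        isInput   : ∀ X → X ∈ inputs ⇔ π X ∘ F ≈ π X
        mechanism : ∀ X → X ∈ nonInputs → LeastFactorisation (π X ∘ F)
        acyclic   : Acyclic (Edge V λ X p → LeastFactorisation.P (mechanism X p))

    𝖬[_] : {F : ⟦all⟧ ⇒ ⟦all⟧} → AcyclicChannel F → Model V
    𝖬[ a ] = record
      { Pa      = λ X p → LeastFactorisation.P (mechanism X p)
      ; channel = λ X p → LeastFactorisation.c (mechanism X p)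
      ; acyclic = acyclic
      }
      where open AcyclicChannel a

    module _ (M : Model V) where
      open Model M

      Mechanism : Var → Set ℓ
      Mechanism X = Σ[ P ∈ Subset size ] ⟦ P ⟧ ⇒ ob X

      Changes : Set ℓ
      Changes = ∀ X → X ∈ nonInputs → Maybe (Mechanism X)

      updated : Changes → ∀ X → X ∈ nonInputs → Mechanism X
      updated ch X p = maybe′ id (Pa X p , channel X p) (ch X p)

      record Intervention : Set ℓ where
        field
          change     : Changes
          acyclicNew : Acyclic (Edge V λ X p → proj₁ (updated change X p))

      trivial : Intervention
      trivial = record { change = λ _ _ → nothing ; acyclicNew = acyclic }

    infix 20 _⟪_⟫
    _⟪_⟫ : (M : Model V) → Intervention M → Model V
    M ⟪ σ ⟫ = record
      { Pa      = λ X p → proj₁ (updated M change X p)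
      ; channel = λ X p → proj₂ (updated M change X p)
      ; acyclic = acyclicNew
      }
      where open Intervention σ

    -- The intervention on N with N ⟪ replaceBy N N′ ⟫ = N′.
    replaceBy : (N N′ : Model V) → Intervention N
    replaceBy N N′ = record
      { change     = λ X p → just (Model.Pa N′ X p , Model.channel N′ X p)
      ; acyclicNew = Model.acyclic N′
      }

  -- Query signatures with types in and out and all queries of type in → out,
  -- together with a model of the signature.
  record IOQueries (q r : Level) : Set (o ⊔ ℓ ⊔ suc (q ⊔ r)) where
    field
      queries : Setoid q r
      ⟦_⟧ᵗ    : IOType → Obj
    open Setoid queries public renaming (Carrier to Query; _≈_ to _≈q_) using ()
    field
      ⟦_⟧q : Query → ⟦ inᵗ ⟧ᵗ ⇒ ⟦ outᵗ ⟧ᵗ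

  -- Two interventions count as equal when all resulting mechanisms agree as
  -- channels on the set of all variables, that is, up to parents which a
  -- mechanism merely discards.
  ioQueries : ∀ {i} {V : Variables} (M : Model V) → Pred (Intervention M) i → IOQueries (ℓ ⊔ i) e
  ioQueries {V = V} M 𝓘 = record
    { queries = On.setoid {B = Σ (Intervention M) 𝓘} (homSetoid ⟦all⟧ ⟦all⟧)
                          (λ (σ , _) → parallel (M ⟪ σ ⟫))
    ; ⟦_⟧ᵗ    = ⟦_⟧ᵗ
    ; ⟦_⟧q    = λ (σ , _) → io (M ⟪ σ ⟫)
    }
    where open Variables V

  -- The partial map ω is given on the domain D.
  record IsUpwardAbstraction {q r q′ r′ d : Level} (𝓛 : IOQueries q r) (𝓗 : IOQueries q′ r′)
      (τ : ∀ t → IOQueries.⟦_⟧ᵗ 𝓛 t ⇒ IOQueries.⟦_⟧ᵗ 𝓗 t)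
      (D : Pred (IOQueries.Query 𝓛) d)
      (ω : ∀ σ → D σ → IOQueries.Query 𝓗) : Set (o ⊔ ℓ ⊔ e ⊔ q ⊔ r ⊔ q′ ⊔ r′ ⊔ d) where
    private
      module 𝓛 = IOQueries 𝓛
      module 𝓗 = IOQueries 𝓗
    field
      τ-deterministic : ∀ t → Deterministic (τ t)
      τ-epic          : ∀ t → Epic (τ t)
      ⨂τ-epic         : ∀ ts → Epic (⨂₁ τ ts)
      D-resp          : D Respects 𝓛._≈q_
      ω-cong          : ∀ {σ σ′} (s : D σ) (s′ : D σ′) → σ 𝓛.≈q σ′ → ω σ s 𝓗.≈q ω σ′ s′
      ω-surjective    : ∀ κ → ∃ λ σ → Σ[ s ∈ D σ ] ω σ s 𝓗.≈q κ
      commutes        : ∀ σ (s : D σ) → τ outᵗ ∘ 𝓛.⟦ σ ⟧q ≈ 𝓗.⟦ ω σ s ⟧q ∘ τ inᵗ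

  module _ (V W : Variables) (ρ : DeterministicIso (Variables.⟦all⟧ V) (Variables.⟦all⟧ W)) where
    private
      module V = Variables V
      module W = Variables W
      module ρ = DeterministicIso ρ

    record Respects (M : Model V) : Set (ℓ ⊔ e) where
      field
        ρⁱⁿ            : Iso V.⟦in⟧ W.⟦in⟧
        ρⁿⁱⁿ           : Iso V.⟦nin⟧ W.⟦nin⟧
        splits         : W.split ∘ ρ.to ≈ (Iso.to ρⁱⁿ ⊗₁ Iso.to ρⁿⁱⁿ) ∘ V.split
        acyclicChannel : AcyclicChannel {W} (ρ.to ∘ parallel M ∘ ρ.from)

      inducedModel : Model W
      inducedModel = 𝖬[ acyclicChannel ]

      τ : ∀ t → V.⟦ t ⟧ᵗ ⇒ W.⟦ t ⟧ᵗ
      τ inᵗ  = Iso.to ρⁱⁿ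
      τ outᵗ = Iso.to ρⁿⁱⁿ

    RespectsAll : ∀ {i} (M : Model V) → Pred (Intervention M) i → Set (ℓ ⊔ e ⊔ i)
    RespectsAll M 𝓘 = ∀ {σ} → 𝓘 σ → Respects (M ⟪ σ ⟫)

    module Induced {i} (M : Model V) (𝓘 : Pred (Intervention M) i)
                   (trivial∈ : 𝓘 (trivial M)) (respects : RespectsAll M 𝓘) where

      respectsM : Respects M
      respectsM = respects trivial∈

      open Respects respectsM public using (ρⁱⁿ; ρⁿⁱⁿ; τ)

      ρ[M] : Model W
      ρ[M] = Respects.inducedModel respectsM

      ρ̂ : ∀ {σ} → 𝓘 σ → Intervention ρ[M]
      ρ̂ s = replaceBy ρ[M] (Respects.inducedModel (respects s))

      ρ̂[𝓘] : Pred (Intervention ρ[M]) (ℓ ⊔ i)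
      ρ̂[𝓘] κ = ∃ λ σ → Σ[ s ∈ 𝓘 σ ] κ ≡ ρ̂ {σ} s

      ω : Σ (Intervention M) 𝓘 → Σ (Intervention ρ[M]) ρ̂[𝓘]
      ω (σ , s) = ρ̂ s , σ , s , refl

{-# OPTIONS --safe #-}
module Submission where

-- Deterministic channels form a cartesian category, and there io M factors
-- through the unique deterministic solution s : Vⁱⁿ → V of F_M ∘ s = s whose
-- restriction to Vⁱⁿ is the identity: io M is the non-input part of s.
-- The channel ρ ∘ s ∘ (ρⁱⁿ)⁻¹ solves the corresponding equations for
-- ρ ∘ F_M ∘ ρ⁻¹, which is F of the induced model, so comparing non-input parts
-- gives ρⁿⁱⁿ ∘ io M = io ρ(M) ∘ ρⁱⁿ.

open import Defs
open import Level using (Level)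
open import Data.Fin.Subset using (Subset; _∈_)
open import Data.Fin.Subset.Properties using (_∈?_; x∈∁p⇒x∉p; x∉p⇒x∈∁p)
open import Data.List.Base using (List; []; _∷_; allFin)
open import Data.List.Membership.Propositional using () renaming (_∈_ to _∈ˡ_; _∉_ to _∉ˡ_)
open import Data.List.Membership.Propositional.Properties using (∈-allFin)
open import Data.List.Membership.Propositional.Properties.WithK using (unique⇒irrelevant)
open import Data.List.Relation.Binary.Sublist.Propositional using (_∷_; _∷ʳ_; []; lookup) renaming (_⊆_ to _⊆ˢ_)
open import Data.List.Relation.Binary.Sublist.Propositional.Properties using (filter-⊆)
open import Data.List.Relation.Binary.Subset.Propositional using () renaming (_⊆_ to _⊆ˡ_)
open import Data.List.Relation.Unary.All.Properties using (¬Any⇒All¬)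
open import Data.List.Relation.Unary.AllPairs using (_∷_)
open import Data.List.Relation.Unary.Any using (here; there)
open import Data.List.Relation.Unary.Unique.Propositional using (Unique)
import Data.List.Relation.Unary.Unique.Propositional.Properties as Unique
open import Data.Product.Base using (Σ-syntax; _×_; _,_; proj₁; proj₂)
open import Data.Vec.Properties.WithK using ([]=-irrelevant)
open import Function.Base using (_∘′_)
open import Function.Bundles using (Equivalence)
open import Function.Definitions using (Bijective)
open import Relation.Binary.Structures using (IsEquivalence)
open import Relation.Binary.PropositionalEquality using (refl; cong; subst)
open import Relation.Nullary using (yes; no; contradiction)
open import Relation.Unary using (Pred; U)
import Relation.Binary.Reasoning.Setoid as SetoidReasoning

-- Commuting squares and inverses in a category.

module CategoryProperties {o ℓ e : Level} (𝒞 : Category o ℓ e) where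
  open Category 𝒞

  module ≈ {A B} = IsEquivalence (equiv {A} {B})
  module HomReasoning {A B} = SetoidReasoning (homSetoid A B)
  open HomReasoning

  private variable
    A B C D : Obj

  ∘-congˡ : {f : B ⇒ C} {g g′ : A ⇒ B} → g ≈ g′ → f ∘ g ≈ f ∘ g′
  ∘-congˡ = ∘-cong ≈.refl

  ∘-congʳ : {f f′ : B ⇒ C} {g : A ⇒ B} → f ≈ f′ → f ∘ g ≈ f′ ∘ g
  ∘-congʳ p = ∘-cong p ≈.refl

  pullˡ : {f : C ⇒ D} {g : B ⇒ C} {k : B ⇒ D} {h : A ⇒ B} →
          f ∘ g ≈ k → f ∘ (g ∘ h) ≈ k ∘ h
  pullˡ p = ≈.trans (≈.sym ∘-assoc) (∘-congʳ p)

  pullʳ : {f : C ⇒ D} {g : B ⇒ C} {h : A ⇒ B} {k : A ⇒ C} →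
          g ∘ h ≈ k → (f ∘ g) ∘ h ≈ f ∘ k
  pullʳ p = ≈.trans ∘-assoc (∘-congˡ p)

  cancelˡ : {f : C ⇒ B} {g : B ⇒ C} {h : A ⇒ B} → f ∘ g ≈ idₘ → f ∘ (g ∘ h) ≈ h
  cancelˡ p = ≈.trans (pullˡ p) identityˡ

  cancelʳ : {f : B ⇒ C} {g : A ⇒ B} {h : B ⇒ A} → g ∘ h ≈ idₘ → (f ∘ g) ∘ h ≈ f
  cancelʳ p = ≈.trans (pullʳ p) identityʳ

  paste : ∀ {A B C A′ B′ C′} {a : B ⇒ C} {b : A ⇒ B} {a′ : B′ ⇒ C′} {b′ : A′ ⇒ B′}
          {f : A′ ⇒ A} {g : B′ ⇒ B} {h : C′ ⇒ C} →
          a ∘ g ≈ h ∘ a′ → b ∘ f ≈ g ∘ b′ → (a ∘ b) ∘ f ≈ h ∘ (a′ ∘ b′)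
  paste p q = ≈.trans (pullʳ q) (≈.trans (pullˡ p) ∘-assoc)

  -- Composing the square with `j.from` on the left and `i.from` on the right turns both
  -- isomorphisms around. It yields naturality of `assoc.from` and, with copying for `f` and `g`,
  -- determinism of inverses.
  square-inverse : ∀ {A B A′ B′} {f : A ⇒ A′} {g : B ⇒ B′} (i : Iso A B) (j : Iso A′ B′) →
                   Iso.to j ∘ f ≈ g ∘ Iso.to i → Iso.from j ∘ g ≈ f ∘ Iso.from i
  square-inverse {f = f} {g} i j p = begin
    j.from ∘ g                          ≈⟨ ∘-congˡ (cancelʳ i.to∘from≈id) ⟨
    j.from ∘ ((g ∘ i.to) ∘ i.from)      ≈⟨ ∘-congˡ (∘-congʳ p) ⟨
    j.from ∘ ((j.to ∘ f) ∘ i.from)      ≈⟨ ∘-congˡ ∘-assoc ⟩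
    j.from ∘ (j.to ∘ (f ∘ i.from))      ≈⟨ cancelˡ j.from∘to≈id ⟩
    f ∘ i.from                          ∎
    where module i = Iso i
          module j = Iso j

  section⇒epic : {f : A ⇒ B} {s : B ⇒ A} → f ∘ s ≈ idₘ → Epic f
  section⇒epic {f = f} {s} fs g h p = begin
    g           ≈⟨ cancelʳ fs ⟨
    (g ∘ f) ∘ s ≈⟨ ∘-congʳ p ⟩
    (h ∘ f) ∘ s ≈⟨ cancelʳ fs ⟩
    h           ∎

-- Deterministic channels in a Markov category.

module MarkovProperties {o ℓ e : Level} (𝒞 : MarkovCategory o ℓ e) where
  open MarkovCategory 𝒞
  open CategoryProperties category public
  open HomReasoning

  private variable
    A B C D A′ B′ C′ D′ : Obj

  ⊗-square : {a : A ⇒ B} {f : A′ ⇒ A} {f′ : B′ ⇒ B} {a′ : A′ ⇒ B′}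
             {b : C ⇒ D} {g : C′ ⇒ C} {g′ : D′ ⇒ D} {b′ : C′ ⇒ D′} →
             a ∘ f ≈ f′ ∘ a′ → b ∘ g ≈ g′ ∘ b′ →
             (a ⊗₁ b) ∘ (f ⊗₁ g) ≈ (f′ ⊗₁ g′) ∘ (a′ ⊗₁ b′)
  ⊗-square p q = ≈.trans (≈.sym ⊗-∘) (≈.trans (⊗-cong p q) ⊗-∘)

  id-square : {f : A ⇒ B} → idₘ ∘ f ≈ f ∘ idₘ
  id-square = ≈.trans identityˡ (≈.sym identityʳ)

  ⊗-merge : {g : A ⇒ B} {f : A′ ⇒ A} {g′ : C ⇒ D} {f′ : C′ ⇒ C} {h : A′ ⇒ B} {h′ : C′ ⇒ D} →
            g ∘ f ≈ h → g′ ∘ f′ ≈ h′ → (g ⊗₁ g′) ∘ (f ⊗₁ f′) ≈ h ⊗₁ h′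
  ⊗-merge p q = ≈.trans (≈.sym ⊗-∘) (⊗-cong p q)

  ⊗-inverse : {f : A ⇒ B} {f⁻ : B ⇒ A} {g : C ⇒ D} {g⁻ : D ⇒ C} →
              f ∘ f⁻ ≈ idₘ → g ∘ g⁻ ≈ idₘ → (f ⊗₁ g) ∘ (f⁻ ⊗₁ g⁻) ≈ idₘ
  ⊗-inverse p q = ≈.trans (⊗-merge p q) ⊗-identity

  disc-∘ : (f : A ⇒ B) → disc ∘ f ≈ disc
  disc-∘ f = disc-unique (disc ∘ f)

  -- Being isomorphic to `unit`, the object `unit ⊗₀ unit` is terminal too.
  unit⊗unit-unique : (f g : A ⇒ unit ⊗₀ unit) → f ≈ g
  unit⊗unit-unique f g = begin
    f                                  ≈⟨ cancelˡ unitorˡ.from∘to≈id ⟨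
    unitorˡ.from ∘ (unitorˡ.to ∘ f)    ≈⟨ ∘-congˡ (≈.trans (disc-unique _) (≈.sym (disc-unique _))) ⟩
    unitorˡ.from ∘ (unitorˡ.to ∘ g)    ≈⟨ cancelˡ unitorˡ.from∘to≈id ⟩
    g                                  ∎

  assoc-from-natural : {f : A ⇒ A′} {g : B ⇒ B′} {h : C ⇒ C′} →
                       assoc.from ∘ (f ⊗₁ (g ⊗₁ h)) ≈ ((f ⊗₁ g) ⊗₁ h) ∘ assoc.from
  assoc-from-natural = square-inverse assoc assoc assoc-natural

  middleSwap-natural : {f : A ⇒ A′} {g : B ⇒ B′} {h : C ⇒ C′} {k : D ⇒ D′} →
                       middleSwap ∘ ((f ⊗₁ g) ⊗₁ (h ⊗₁ k)) ≈ ((f ⊗₁ h) ⊗₁ (g ⊗₁ k)) ∘ middleSwap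
  middleSwap-natural =
    paste assoc-from-natural
      (paste (⊗-square id-square
               (paste assoc-natural
                 (paste (⊗-square braiding-natural id-square) assoc-from-natural)))
             assoc-natural)

  -- Braiding two unit wires is an endomorphism of a terminal object, hence the identity, after
  -- which the associators cancel.
  middleSwap-unit : middleSwap {A} {unit} {unit} {B} ≈ idₘ
  middleSwap-unit = begin
    assoc.from ∘ ((idₘ ⊗₁ (assoc.to ∘ ((braiding ⊗₁ idₘ) ∘ assoc.from))) ∘ assoc.to)
      ≈⟨ ∘-congˡ (∘-congʳ (⊗-cong ≈.refl (∘-congˡ (∘-congʳ (⊗-cong (unit⊗unit-unique _ _) ≈.refl))))) ⟩
    assoc.from ∘ ((idₘ ⊗₁ (assoc.to ∘ ((idₘ ⊗₁ idₘ) ∘ assoc.from))) ∘ assoc.to)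
      ≈⟨ ∘-congˡ (∘-congʳ (⊗-cong ≈.refl (∘-congˡ (≈.trans (∘-congʳ ⊗-identity) identityˡ)))) ⟩
    assoc.from ∘ ((idₘ ⊗₁ (assoc.to ∘ assoc.from)) ∘ assoc.to)
      ≈⟨ ∘-congˡ (∘-congʳ (≈.trans (⊗-cong ≈.refl assoc.to∘from≈id) ⊗-identity)) ⟩
    assoc.from ∘ (idₘ ∘ assoc.to)
      ≈⟨ ∘-congˡ identityˡ ⟩
    assoc.from ∘ assoc.to
      ≈⟨ assoc.from∘to≈id ⟩
    idₘ ∎

  -- All four outputs are copies of one wire. Coassociativity brings them to right-nested form,
  -- where cocommutativity absorbs the exchange of the middle two. This is what makes `copy` itself
  -- deterministic.
  middleSwap-copy : middleSwap ∘ ((copy ⊗₁ copy) ∘ copy) ≈ (copy ⊗₁ copy) ∘ copy {A}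
  middleSwap-copy = begin
    middleSwap ∘ ((copy ⊗₁ copy) ∘ copy)
      ≈⟨ pullʳ (pullʳ reassociate) ⟩
    assoc.from ∘ ((idₘ ⊗₁ swapˡ) ∘ ((idₘ ⊗₁ ((idₘ ⊗₁ copy) ∘ copy)) ∘ copy))
      ≈⟨ ∘-congˡ (pullˡ (⊗-merge identityˡ swapˡ-copy)) ⟩
    assoc.from ∘ ((idₘ ⊗₁ ((idₘ ⊗₁ copy) ∘ copy)) ∘ copy)
      ≈⟨ ∘-congˡ reassociate ⟨
    assoc.from ∘ (assoc.to ∘ ((copy ⊗₁ copy) ∘ copy))
      ≈⟨ cancelˡ assoc.from∘to≈id ⟩
    (copy ⊗₁ copy) ∘ copy ∎
    where
      swapˡ : ∀ {A B C} → A ⊗₀ (B ⊗₀ C) ⇒ B ⊗₀ (A ⊗₀ C)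
      swapˡ = assoc.to ∘ (braiding ⊗₁ idₘ) ∘ assoc.from

      swapˡ-copy : swapˡ ∘ ((idₘ ⊗₁ copy) ∘ copy) ≈ (idₘ ⊗₁ copy) ∘ copy {A}
      swapˡ-copy = begin
        swapˡ ∘ ((idₘ ⊗₁ copy) ∘ copy)
          ≈⟨ ∘-congˡ copy-coassoc ⟨
        swapˡ ∘ (assoc.to ∘ ((copy ⊗₁ idₘ) ∘ copy))
          ≈⟨ pullʳ (pullʳ (cancelˡ assoc.from∘to≈id)) ⟩
        assoc.to ∘ ((braiding ⊗₁ idₘ) ∘ ((copy ⊗₁ idₘ) ∘ copy))
          ≈⟨ ∘-congˡ (pullˡ (⊗-merge copy-cocommute identityˡ)) ⟩
        assoc.to ∘ ((copy ⊗₁ idₘ) ∘ copy)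
          ≈⟨ copy-coassoc ⟩
        (idₘ ⊗₁ copy) ∘ copy ∎

      reassociate : assoc.to ∘ ((copy ⊗₁ copy) ∘ copy) ≈ (idₘ ⊗₁ ((idₘ ⊗₁ copy) ∘ copy)) ∘ copy {A}
      reassociate = begin
        assoc.to ∘ ((copy ⊗₁ copy) ∘ copy)
          -- The second copying is postponed and the identity on the left pair is split as
          -- `idₘ ⊗₁ idₘ`, so that `assoc-natural` applies.
          ≈⟨ ∘-congˡ (∘-congʳ (⊗-merge (≈.trans (∘-congʳ ⊗-identity) identityˡ) identityʳ)) ⟨
        assoc.to ∘ ((((idₘ ⊗₁ idₘ) ⊗₁ copy) ∘ (copy ⊗₁ idₘ)) ∘ copy)
          ≈⟨ ∘-congˡ ∘-assoc ⟩
        assoc.to ∘ (((idₘ ⊗₁ idₘ) ⊗₁ copy) ∘ ((copy ⊗₁ idₘ) ∘ copy))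
          ≈⟨ pullˡ assoc-natural ⟩
        ((idₘ ⊗₁ (idₘ ⊗₁ copy)) ∘ assoc.to) ∘ ((copy ⊗₁ idₘ) ∘ copy)
          ≈⟨ pullʳ copy-coassoc ⟩
        (idₘ ⊗₁ (idₘ ⊗₁ copy)) ∘ ((idₘ ⊗₁ copy) ∘ copy)
          ≈⟨ pullˡ (⊗-merge identityˡ ≈.refl) ⟩
        (idₘ ⊗₁ ((idₘ ⊗₁ copy) ∘ copy)) ∘ copy ∎

  det-resp : {f g : A ⇒ B} → f ≈ g → Deterministic f → Deterministic g
  det-resp {f = f} {g} p d = begin
    copy ∘ g          ≈⟨ ∘-congˡ p ⟨
    copy ∘ f          ≈⟨ d ⟩
    (f ⊗₁ f) ∘ copy   ≈⟨ ∘-congʳ (⊗-cong p p) ⟩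
    (g ⊗₁ g) ∘ copy   ∎

  det-id : Deterministic (idₘ {A})
  det-id = ≈.trans identityʳ (≈.sym (≈.trans (∘-congʳ ⊗-identity) identityˡ))

  det-∘ : {g : B ⇒ C} {f : A ⇒ B} → Deterministic g → Deterministic f → Deterministic (g ∘ f)
  det-∘ {g = g} {f} dg df = begin
    copy ∘ (g ∘ f)                   ≈⟨ pullˡ dg ⟩
    ((g ⊗₁ g) ∘ copy) ∘ f            ≈⟨ pullʳ df ⟩
    (g ⊗₁ g) ∘ ((f ⊗₁ f) ∘ copy)     ≈⟨ pullˡ (≈.sym ⊗-∘) ⟩
    ((g ∘ f) ⊗₁ (g ∘ f)) ∘ copy      ∎

  det-disc : Deterministic (disc {A})
  det-disc = unit⊗unit-unique _ _

  det-copy : Deterministic (copy {A})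
  det-copy = ≈.trans (∘-congʳ copy-⊗) (≈.trans ∘-assoc middleSwap-copy)

  det-⊗ : {f : A ⇒ A′} {g : B ⇒ B′} → Deterministic f → Deterministic g → Deterministic (f ⊗₁ g)
  det-⊗ {f = f} {g} df dg = begin
    copy ∘ (f ⊗₁ g)
      ≈⟨ ∘-congʳ copy-⊗ ⟩
    (middleSwap ∘ (copy ⊗₁ copy)) ∘ (f ⊗₁ g)
      ≈⟨ paste middleSwap-natural (⊗-square df dg) ⟩
    ((f ⊗₁ g) ⊗₁ (f ⊗₁ g)) ∘ (middleSwap ∘ (copy ⊗₁ copy))
      ≈⟨ ∘-congˡ copy-⊗ ⟨
    ((f ⊗₁ g) ⊗₁ (f ⊗₁ g)) ∘ copy ∎

  -- Determinism is a commuting square between copy maps, with `i` on one side and `i⊗i` on the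
  -- other, so `square-inverse` applies.
  det-from : (i : Iso A B) → Deterministic (Iso.to i) → Deterministic (Iso.from i)
  det-from i d = ≈.sym (square-inverse i i⊗i (≈.sym d))
    where
      open Iso i
      i⊗i = record
        { to = to ⊗₁ to ; from = from ⊗₁ from
        ; to∘from≈id = ⊗-inverse to∘from≈id to∘from≈id
        ; from∘to≈id = ⊗-inverse from∘to≈id from∘to≈id }

  -- A channel with a right inverse is epic, so determinism of `f` may be tested after `r`. Only `r`
  -- has to be deterministic, which leaves `s` free to insert arbitrary states.
  det-cancelʳ : {f : B ⇒ C} {r : A ⇒ B} {s : B ⇒ A} → r ∘ s ≈ idₘ →
                Deterministic r → Deterministic (f ∘ r) → Deterministic f
  det-cancelʳ {f = f} {r} rs dr dfr = section⇒epic rs _ _ (begin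
    (copy ∘ f) ∘ r                     ≈⟨ ∘-assoc ⟩
    copy ∘ (f ∘ r)                     ≈⟨ dfr ⟩
    ((f ∘ r) ⊗₁ (f ∘ r)) ∘ copy        ≈⟨ pullˡ (≈.sym ⊗-∘) ⟨
    (f ⊗₁ f) ∘ ((r ⊗₁ r) ∘ copy)       ≈⟨ pullʳ dr ⟨
    ((f ⊗₁ f) ∘ copy) ∘ r              ∎)

  -- Binary products of deterministic channels.

  infix 11 ⟨_,_⟩
  ⟨_,_⟩ : A ⇒ B → A ⇒ C → A ⇒ B ⊗₀ C
  ⟨ f , g ⟩ = (f ⊗₁ g) ∘ copy

  fst : A ⊗₀ B ⇒ A
  fst = unitorʳ.to ∘ (idₘ ⊗₁ disc)

  snd : A ⊗₀ B ⇒ B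
  snd = unitorˡ.to ∘ (disc ⊗₁ idₘ)

  fst-⊗ : {f : A ⇒ A′} {g : B ⇒ B′} → fst ∘ (f ⊗₁ g) ≈ f ∘ fst
  fst-⊗ {f = f} {g} = begin
    fst ∘ (f ⊗₁ g)                                   ≈⟨ ∘-assoc ⟩
    unitorʳ.to ∘ ((idₘ ⊗₁ disc) ∘ (f ⊗₁ g))          ≈⟨ ∘-congˡ (⊗-square id-square (≈.trans (disc-∘ g) (≈.sym identityˡ))) ⟩
    unitorʳ.to ∘ ((f ⊗₁ idₘ) ∘ (idₘ ⊗₁ disc))        ≈⟨ pullˡ unitorʳ-natural ⟩
    (f ∘ unitorʳ.to) ∘ (idₘ ⊗₁ disc)                 ≈⟨ ∘-assoc ⟩
    f ∘ fst ∎

  snd-⊗ : {f : A ⇒ A′} {g : B ⇒ B′} → snd ∘ (f ⊗₁ g) ≈ g ∘ snd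
  snd-⊗ {f = f} {g} = begin
    snd ∘ (f ⊗₁ g)                                   ≈⟨ ∘-assoc ⟩
    unitorˡ.to ∘ ((disc ⊗₁ idₘ) ∘ (f ⊗₁ g))          ≈⟨ ∘-congˡ (⊗-square (≈.trans (disc-∘ f) (≈.sym identityˡ)) id-square) ⟩
    unitorˡ.to ∘ ((idₘ ⊗₁ g) ∘ (disc ⊗₁ idₘ))        ≈⟨ pullˡ unitorˡ-natural ⟩
    (g ∘ unitorˡ.to) ∘ (disc ⊗₁ idₘ)                 ≈⟨ ∘-assoc ⟩
    g ∘ snd ∎

  fst-⟨⟩ : {f : A ⇒ B} {g : A ⇒ C} → fst ∘ ⟨ f , g ⟩ ≈ f
  fst-⟨⟩ = ≈.trans (pullˡ fst-⊗) (cancelʳ (≈.trans ∘-assoc copy-counitʳ))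

  snd-⟨⟩ : {f : A ⇒ B} {g : A ⇒ C} → snd ∘ ⟨ f , g ⟩ ≈ g
  snd-⟨⟩ = ≈.trans (pullˡ snd-⊗) (cancelʳ (≈.trans ∘-assoc copy-counitˡ))

  ⟨⟩-∘ : {f : B ⇒ C} {g : B ⇒ D} {h : A ⇒ B} → Deterministic h → ⟨ f , g ⟩ ∘ h ≈ ⟨ f ∘ h , g ∘ h ⟩
  ⟨⟩-∘ dh = ≈.trans (pullʳ dh) (pullˡ (≈.sym ⊗-∘))

  -- Copying a pair ends in `middleSwap`, whose two inner wires the projections discard. By
  -- naturality the discards move before it, so it only exchanges unit wires and vanishes; the
  -- counit laws do the rest.
  ⟨fst,snd⟩≈id : ⟨ fst , snd ⟩ ≈ idₘ {A ⊗₀ B}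
  ⟨fst,snd⟩≈id = begin
    (fst ⊗₁ snd) ∘ copy
      ≈⟨ ∘-cong ⊗-∘ copy-⊗ ⟩
    ((unitorʳ.to ⊗₁ unitorˡ.to) ∘ ((idₘ ⊗₁ disc) ⊗₁ (disc ⊗₁ idₘ))) ∘ (middleSwap ∘ (copy ⊗₁ copy))
      ≈⟨ pullʳ (pullˡ (≈.sym middleSwap-natural)) ⟩
    (unitorʳ.to ⊗₁ unitorˡ.to) ∘ ((middleSwap ∘ ((idₘ ⊗₁ disc) ⊗₁ (disc ⊗₁ idₘ))) ∘ (copy ⊗₁ copy))
      ≈⟨ ∘-congˡ (∘-congʳ (≈.trans (∘-congʳ middleSwap-unit) identityˡ)) ⟩
    (unitorʳ.to ⊗₁ unitorˡ.to) ∘ (((idₘ ⊗₁ disc) ⊗₁ (disc ⊗₁ idₘ)) ∘ (copy ⊗₁ copy))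
      ≈⟨ ∘-congˡ (⊗-merge ≈.refl ≈.refl) ⟩
    (unitorʳ.to ⊗₁ unitorˡ.to) ∘ (((idₘ ⊗₁ disc) ∘ copy) ⊗₁ ((disc ⊗₁ idₘ) ∘ copy))
      ≈⟨ ⊗-inverse copy-counitʳ copy-counitˡ ⟩
    idₘ ∎

  -- The eta law `η` recovers a deterministic channel from its marginals. For a general channel the
  -- marginals do not determine the joint.
  pair-unique : {f g : A ⇒ B ⊗₀ C} → Deterministic f → Deterministic g →
                fst ∘ f ≈ fst ∘ g → snd ∘ f ≈ snd ∘ g → f ≈ g
  pair-unique {f = f} {g} df dg p q = begin
    f                           ≈⟨ η df ⟩
    ⟨ fst ∘ f , snd ∘ f ⟩       ≈⟨ ∘-congʳ (⊗-cong p q) ⟩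
    ⟨ fst ∘ g , snd ∘ g ⟩       ≈⟨ η dg ⟨
    g                           ∎
    where
      η : ∀ {A B C} {f : A ⇒ B ⊗₀ C} → Deterministic f → f ≈ ⟨ fst ∘ f , snd ∘ f ⟩
      η df = ≈.trans (≈.sym identityˡ) (≈.trans (∘-congʳ (≈.sym ⟨fst,snd⟩≈id)) (⟨⟩-∘ df))

  det-⟨⟩ : {f : A ⇒ B} {g : A ⇒ C} → Deterministic f → Deterministic g → Deterministic ⟨ f , g ⟩
  det-⟨⟩ df dg = det-∘ (det-⊗ df dg) det-copy

  section≈from : (i : Iso A B) {s : B ⇒ A} → Iso.to i ∘ s ≈ idₘ → s ≈ Iso.from i
  section≈from i p = ≈.trans (≈.sym (cancelˡ (Iso.from∘to≈id i))) (≈.trans (∘-congˡ p) identityʳ)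

  inverse : Iso A B → Iso B A
  inverse i = record { to = from ; from = to ; to∘from≈id = from∘to≈id ; from∘to≈id = to∘from≈id }
    where open Iso i

  det-fst : Deterministic (fst {A} {B})
  -- `unitorʳ.from` is the pairing of the identity with `disc`, hence deterministic; `det-from` for
  -- the inverse isomorphism carries this over to `unitorʳ.to`.
  det-fst = det-∘ (det-from (inverse unitorʳ)
      (det-resp (section≈from unitorʳ copy-counitʳ) (det-⟨⟩ det-id det-disc)))
    (det-⊗ det-id det-disc)

  det-snd : Deterministic (snd {A} {B})
  det-snd = det-∘ (det-from (inverse unitorˡ)
      (det-resp (section≈from unitorˡ copy-counitˡ) (det-⟨⟩ det-disc det-id)))
    (det-⊗ det-disc det-id)

  -- Tensor products need not preserve epics, but right inverses are tensored componentwise. The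
  -- tensor products of components of `τ` are shown epic in this way.
  ⨂-section : ∀ {k} {K : Set k} {A B : K → Obj} {f : ∀ i → A i ⇒ B i} {g : ∀ i → B i ⇒ A i} →
              (∀ i → f i ∘ g i ≈ idₘ) → ∀ is → ⨂₁ f is ∘ ⨂₁ g is ≈ idₘ
  ⨂-section p []       = identityˡ
  ⨂-section p (i ∷ is) = ⊗-inverse (p i) (⨂-section p is)

  -- Finite products: projections, tuples and selections of wires.

  module _ {k} {K : Set k} (A : K → Obj) where

    proj-there : ∀ {i j is} (i∈ : i ∈ˡ is) → proj A (there {x = j} i∈) ≈ proj A i∈ ∘ snd
    proj-there i∈ = begin
      unitorˡ.to ∘ (disc ⊗₁ proj A i∈)                    ≈⟨ ∘-congˡ (⊗-merge identityˡ identityʳ) ⟨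
      unitorˡ.to ∘ ((idₘ ⊗₁ proj A i∈) ∘ (disc ⊗₁ idₘ))   ≈⟨ pullˡ unitorˡ-natural ⟩
      (proj A i∈ ∘ unitorˡ.to) ∘ (disc ⊗₁ idₘ)            ≈⟨ ∘-assoc ⟩
      proj A i∈ ∘ snd                                     ∎

    det-proj : ∀ {i is} (i∈ : i ∈ˡ is) → Deterministic (proj A i∈)
    det-proj (here refl) = det-fst
    det-proj (there i∈)  = det-resp (≈.sym (proj-there i∈)) (det-∘ (det-proj i∈) det-snd)

    det-tuple : ∀ {C} is {f : ∀ {i} → i ∈ˡ is → C ⇒ A i} →
                (∀ {i} (i∈ : i ∈ˡ is) → Deterministic (f i∈)) → Deterministic (tuple A is f)
    det-tuple []           d = det-disc
    det-tuple (i ∷ is) {f} d = det-⟨⟩ (d (here refl)) (det-tuple is {f ∘′ there} (λ i∈ → d (there i∈)))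

    det-rewire : ∀ {is js} (js⊆is : js ⊆ˡ is) → Deterministic (rewire A is js js⊆is)
    det-rewire {js = js} js⊆is = det-tuple js λ j∈ → det-proj (js⊆is j∈)

    tuple-cong : ∀ {C} is {f g : ∀ {i} → i ∈ˡ is → C ⇒ A i} →
                 (∀ {i} (i∈ : i ∈ˡ is) → f i∈ ≈ g i∈) → tuple A is f ≈ tuple A is g
    tuple-cong []       p = ≈.refl
    tuple-cong (i ∷ is) p = ∘-congʳ (⊗-cong (p (here refl)) (tuple-cong is (λ i∈ → p (there i∈))))

    tuple-∘ : ∀ {C D} is {f : ∀ {i} → i ∈ˡ is → D ⇒ A i} {h : C ⇒ D} → Deterministic h →
              tuple A is f ∘ h ≈ tuple A is (λ i∈ → f i∈ ∘ h)
    tuple-∘ []       dh = disc-∘ _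
    tuple-∘ (i ∷ is) dh = ≈.trans (⟨⟩-∘ dh) (∘-congʳ (⊗-cong ≈.refl (tuple-∘ is dh)))

    proj-tuple : ∀ {C i is} {f : ∀ {i} → i ∈ˡ is → C ⇒ A i} (i∈ : i ∈ˡ is) →
                 proj A i∈ ∘ tuple A is f ≈ f i∈
    proj-tuple (here refl) = fst-⟨⟩
    proj-tuple (there i∈)  = ≈.trans (∘-congʳ (proj-there i∈)) (≈.trans (pullʳ snd-⟨⟩) (proj-tuple i∈))

    ⨂-unique : ∀ {C} is {f g : C ⇒ ⨂₀ A is} → Deterministic f → Deterministic g →
               (∀ {i} (i∈ : i ∈ˡ is) → proj A i∈ ∘ f ≈ proj A i∈ ∘ g) → f ≈ g
    ⨂-unique []       df dg p = ≈.trans (disc-unique _) (≈.sym (disc-unique _))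
    ⨂-unique (i ∷ is) df dg p =
      pair-unique df dg (p (here refl))
        (⨂-unique is (det-∘ det-snd df) (det-∘ det-snd dg) λ i∈ →
          ≈.trans (pullˡ (≈.sym (proj-there i∈)))
            (≈.trans (p (there i∈)) (≈.sym (pullˡ (≈.sym (proj-there i∈))))))

    -- A form of `rewire` by recursion on the sublist relation, so that a right inverse can be built
    -- by the same recursion.
    keep : ∀ {is js} → js ⊆ˢ is → ⨂₀ A is ⇒ ⨂₀ A js
    keep []         = idₘ
    keep (_ ∷ʳ s)   = keep s ∘ snd
    keep (refl ∷ s) = idₘ ⊗₁ keep s

    -- The inserted states need not be sharp, so insert need not be deterministic.
    insert : (∀ i → State (A i)) → ∀ {is js} → js ⊆ˢ is → ⨂₀ A js ⇒ ⨂₀ A is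
    insert x []         = idₘ
    insert x (i ∷ʳ s)   = (x i ⊗₁ insert x s) ∘ unitorˡ.from
    insert x (refl ∷ s) = idₘ ⊗₁ insert x s

    keep-insert : (x : ∀ i → State (A i)) → ∀ {is js} (s : js ⊆ˢ is) → keep s ∘ insert x s ≈ idₘ
    keep-insert x []       = identityˡ
    keep-insert x (i ∷ʳ s) = begin
      (keep s ∘ snd) ∘ ((x i ⊗₁ insert x s) ∘ unitorˡ.from)  ≈⟨ pullʳ (pullˡ snd-⊗) ⟩
      keep s ∘ ((insert x s ∘ snd) ∘ unitorˡ.from)           ≈⟨ ∘-congˡ (cancelʳ snd-from) ⟩
      keep s ∘ insert x s                                    ≈⟨ keep-insert x s ⟩
      idₘ                                                    ∎
      where
        snd-from : ∀ {B} → snd ∘ unitorˡ.from {B} ≈ idₘ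
        snd-from = begin
          (unitorˡ.to ∘ (disc ⊗₁ idₘ)) ∘ unitorˡ.from
            ≈⟨ ∘-congʳ (∘-congˡ (⊗-cong (≈.sym (disc-unique idₘ)) ≈.refl)) ⟩
          (unitorˡ.to ∘ (idₘ ⊗₁ idₘ)) ∘ unitorˡ.from
            ≈⟨ ∘-congʳ (≈.trans (∘-congˡ ⊗-identity) identityʳ) ⟩
          unitorˡ.to ∘ unitorˡ.from
            ≈⟨ unitorˡ.to∘from≈id ⟩
          idₘ ∎
    keep-insert x (refl ∷ s) = ⊗-inverse identityˡ (keep-insert x s)

    det-keep : ∀ {is js} (s : js ⊆ˢ is) → Deterministic (keep s)
    det-keep []         = det-id
    det-keep (_ ∷ʳ s)   = det-∘ (det-keep s) det-snd
    det-keep (refl ∷ s) = det-⊗ det-id (det-keep s)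

    proj-keep : ∀ {i is js} (s : js ⊆ˢ is) (i∈ : i ∈ˡ js) →
                proj A i∈ ∘ keep s ≈ proj A (lookup s i∈)
    proj-keep (_ ∷ʳ s) i∈ =
      ≈.trans (pullˡ (proj-keep s i∈)) (≈.sym (proj-there (lookup s i∈)))
    proj-keep (refl ∷ s) (here refl) = ≈.trans fst-⊗ identityˡ
    proj-keep (refl ∷ s) (there i∈)  = begin
      proj A (there i∈) ∘ (idₘ ⊗₁ keep s)   ≈⟨ ∘-congʳ (proj-there i∈) ⟩
      (proj A i∈ ∘ snd) ∘ (idₘ ⊗₁ keep s)   ≈⟨ pullʳ snd-⊗ ⟩
      proj A i∈ ∘ (keep s ∘ snd)            ≈⟨ pullˡ (proj-keep s i∈) ⟩
      proj A (lookup s i∈) ∘ snd            ≈⟨ proj-there (lookup s i∈) ⟨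
      proj A (there (lookup s i∈))          ∎

    -- Both sides are deterministic, so projections suffice; these agree because in a list without
    -- repetitions each element has only one membership proof.
    rewire≈keep : ∀ {is js} → Unique is → (js⊆is : js ⊆ˡ is) (s : js ⊆ˢ is) →
                  rewire A is js js⊆is ≈ keep s
    rewire≈keep {is} {js} uniq js⊆is s =
      ⨂-unique js (det-rewire js⊆is) (det-keep s) λ j∈ → begin
        proj A j∈ ∘ rewire A is js js⊆is   ≈⟨ proj-tuple j∈ ⟩
        proj A (js⊆is j∈)                  ≡⟨ cong (proj A) (unique⇒irrelevant uniq (js⊆is j∈) (lookup s j∈)) ⟩
        proj A (lookup s j∈)               ≈⟨ proj-keep s j∈ ⟨
        proj A j∈ ∘ keep s                 ∎

-- Restrictions, marginals and wirings of causal models.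

module CausalModelProperties {o ℓ e : Level} (𝒞 : MarkovCategory o ℓ e) where
  open MarkovCategory 𝒞
  open CausalModels 𝒞
  open MarkovProperties 𝒞
  open HomReasoning

  unique-elements : ∀ {n} (S : Subset n) → Unique (elements S)
  unique-elements {n} S = Unique.filter⁺ (_∈? S) (Unique.allFin⁺ n)

  module _ (V : Variables) where
    open Variables V

    det-π : ∀ X → Deterministic (π X)
    det-π X = det-proj ob (∈-allFin X)

    det-restrict : ∀ S → Deterministic (restrict S)
    det-restrict S = det-rewire ob {allFin size} {elements S} λ {X} _ → ∈-allFin X

    -- `π` fixes one membership proof for each variable; it is the only one, since `allFin` has no
    -- repetitions.
    all-unique : ∀ {C} {f g : C ⇒ ⟦all⟧} → Deterministic f → Deterministic g →
                 (∀ X → π X ∘ f ≈ π X ∘ g) → f ≈ g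
    all-unique {f = f} {g} df dg p = ⨂-unique ob (allFin size) df dg λ {X} X∈ →
      subst (λ X∈ → proj ob X∈ ∘ f ≈ proj ob X∈ ∘ g)
            (unique⇒irrelevant (Unique.allFin⁺ size) (∈-allFin X) X∈) (p X)

    module _ (x : ∀ X → State (ob X)) where

      section : ∀ S → ⟦ S ⟧ ⇒ ⟦all⟧
      section S = insert ob x (filter-⊆ (_∈? S) (allFin size))

      -- Filling the discarded wires with states makes `restrict S` split epic, which lets
      -- determinism be cancelled along it by `det-cancelʳ`.
      restrict-section : ∀ S → restrict S ∘ section S ≈ idₘ
      restrict-section S =
        ≈.trans (∘-congʳ (rewire≈keep ob (Unique.allFin⁺ size) (λ {X} _ → ∈-allFin X) kept))
                (keep-insert ob x kept)
        where kept = filter-⊆ (_∈? S) (allFin size)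

  module _ {V : Variables} where
    open Variables V

    module _ (M : Model V) where
      open Model M

      -- `component` finds its own proof of membership in `nonInputs`; irrelevance of such proofs
      -- identifies it with `p`.
      component-nonInput : ∀ {X} (p : X ∈ nonInputs) →
                           component M X ≈ channel X p ∘ restrict (Pa X p)
      component-nonInput {X} p with X ∈? inputs
      ... | yes X∈in = contradiction X∈in (x∈∁p⇒x∉p p)
      ... | no X∉in  = ≈.reflexive (cong (λ p → channel X p ∘ restrict (Pa X p))
                                         ([]=-irrelevant (x∉p⇒x∈∁p X∉in) p))

      π-parallel : ∀ X → π X ∘ parallel M ≈ component M X
      π-parallel X = proj-tuple ob (∈-allFin X)

      unique-ordering : ∀ {Xs} → Ordering M Xs → Unique Xs
      unique-ordering start             = unique-elements inputs
      unique-ordering (extend _ X∉ _ o) = ¬Any⇒All¬ _ X∉ ∷ unique-ordering o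

    module _ {M : Model V} (detM : DeterministicModel M) where
      open Model M

      det-component : ∀ X → Deterministic (component M X)
      det-component X with X ∈? inputs
      ... | yes _ = det-π V X
      ... | no _  = det-∘ (detM X _) (det-restrict V _)

      det-parallel : Deterministic (parallel M)
      det-parallel = det-tuple ob (allFin size) λ {X} _ → det-component X

      det-wire : ∀ {Xs} (o : Ordering M Xs) → Deterministic (wire M o)
      det-wire start                = det-id
      det-wire (extend p _ Pa⊆Xs o) =
        det-∘ (det-⊗ (det-∘ (detM _ p) (det-rewire ob Pa⊆Xs)) det-id) (det-∘ det-copy (det-wire o))

      proj-wire-here : ∀ {Xs X} (p : X ∈ nonInputs) (X∉ : X ∉ˡ Xs) (Pa⊆Xs : elements (Pa X p) ⊆ˡ Xs)
                       (o : Ordering M Xs) →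
                       proj ob (here {xs = Xs} refl) ∘ wire M (extend p X∉ Pa⊆Xs o)
                       ≈ channel X p ∘ tuple ob (elements (Pa X p)) (λ Y∈ → proj ob (Pa⊆Xs Y∈) ∘ wire M o)
      proj-wire-here p X∉ Pa⊆Xs o =
        ≈.trans (∘-congˡ (≈.sym ∘-assoc)) (≈.trans (pullˡ (fst-⟨⟩ {g = idₘ}))
          (pullʳ (tuple-∘ ob (elements (Pa _ p)) (det-wire o))))

      proj-wire-there : ∀ {Xs X Y} (p : X ∈ nonInputs) (X∉ : X ∉ˡ Xs) (Pa⊆Xs : elements (Pa X p) ⊆ˡ Xs)
                        (o : Ordering M Xs) (Y∈ : Y ∈ˡ Xs) →
                        proj ob (there Y∈) ∘ wire M (extend p X∉ Pa⊆Xs o) ≈ proj ob Y∈ ∘ wire M o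
      proj-wire-there p X∉ Pa⊆Xs o Y∈ =
        ≈.trans (∘-congʳ (proj-there ob Y∈))
          (pullʳ (≈.trans (∘-congˡ (≈.sym ∘-assoc)) (≈.trans (pullˡ (snd-⟨⟩ {g = idₘ})) identityˡ)))

    -- Solutions of the structural equations of a deterministic model.

    record Solution (M : Model V) (s : ⟦in⟧ ⇒ ⟦all⟧) : Set e where
      field
        deterministic : Deterministic s
        fixed         : parallel M ∘ s ≈ s
        -- At an input `fixed` is vacuous, as the component there is a projection; this equation
        -- pins the inputs down.
        on-inputs     : restrict inputs ∘ s ≈ idₘ

    module _ {M : Model V} (detM : DeterministicModel M) where
      open Model M

      -- Induction on the ordering: input wires agree by `on-inputs`, and a new wire agrees because
      -- its parents already do and `fixed` applies the same mechanism. For a complete ordering this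
      -- gives uniqueness of solutions.
      wire-solution : ∀ {s} → Solution M s → ∀ {Xs X} (o : Ordering M Xs) (X∈ : X ∈ˡ Xs) →
                      proj ob X∈ ∘ wire M o ≈ π X ∘ s
      wire-solution {s} sol {X = X} start X∈ = begin
        proj ob X∈ ∘ idₘ                       ≈⟨ ∘-congˡ on-inputs ⟨
        proj ob X∈ ∘ (restrict inputs ∘ s)     ≈⟨ pullˡ (proj-tuple ob X∈) ⟩
        π X ∘ s                                ∎
        where open Solution sol
      wire-solution {s} sol {X = X} (extend {Xs} p X∉ Pa⊆Xs o) (here refl) = begin
        proj ob (here {xs = Xs} refl) ∘ wire M (extend p X∉ Pa⊆Xs o)
          ≈⟨ proj-wire-here detM p X∉ Pa⊆Xs o ⟩
        channel X p ∘ tuple ob (elements (Pa X p)) (λ Y∈ → proj ob (Pa⊆Xs Y∈) ∘ wire M o)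
          ≈⟨ ∘-congˡ (tuple-cong ob (elements (Pa X p)) λ Y∈ → wire-solution sol o (Pa⊆Xs Y∈)) ⟩
        channel X p ∘ tuple ob (elements (Pa X p)) (λ {Y} _ → π Y ∘ s)
          ≈⟨ ∘-congˡ (tuple-∘ ob (elements (Pa X p)) deterministic) ⟨
        channel X p ∘ (restrict (Pa X p) ∘ s)
          ≈⟨ pullˡ (≈.sym (component-nonInput M p)) ⟩
        component M X ∘ s
          ≈⟨ pullˡ (π-parallel M X) ⟨
        π X ∘ (parallel M ∘ s)
          ≈⟨ ∘-congˡ fixed ⟩
        π X ∘ s ∎
        where open Solution sol
      wire-solution sol (extend p X∉ Pa⊆Xs o) (there X∈) =
        ≈.trans (proj-wire-there detM p X∉ Pa⊆Xs o X∈) (wire-solution sol o X∈)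

      -- The right-hand side does not mention the ordering, so the order in which mechanisms are
      -- wired is immaterial.
      ioAlong-solution : ∀ {s} → Solution M s → ∀ {Xs} (o : Ordering M Xs) (all⊆ : allFin size ⊆ˡ Xs) →
                         ioAlong M o all⊆ ≈ restrict nonInputs ∘ s
      ioAlong-solution {s} sol {Xs} o all⊆ = begin
        rewire ob Xs (elements nonInputs) (λ {X} _ → all⊆ (∈-allFin X)) ∘ wire M o
          ≈⟨ tuple-∘ ob (elements nonInputs) (det-wire detM o) ⟩
        tuple ob (elements nonInputs) (λ {X} _ → proj ob (all⊆ (∈-allFin X)) ∘ wire M o)
          ≈⟨ tuple-cong ob (elements nonInputs) (λ {X} _ → wire-solution sol o (all⊆ (∈-allFin X))) ⟩
        tuple ob (elements nonInputs) (λ {X} _ → π X ∘ s)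
          ≈⟨ tuple-∘ ob (elements nonInputs) (Solution.deterministic sol) ⟨
        restrict nonInputs ∘ s ∎

      io-solution : ∀ {s} → Solution M s → io M ≈ restrict nonInputs ∘ s
      io-solution sol = let _ , o , all⊆ = topologicalOrder M in ioAlong-solution sol o all⊆

      -- Later extensions leave earlier wires unchanged, so the equation that holds when `X` is
      -- added persists. The inclusion of its parents is returned as a witness because it changes
      -- with each extension.
      proj-wire-nonInput : ∀ {Xs X} (o : Ordering M Xs) (X∈ : X ∈ˡ Xs) (p : X ∈ nonInputs) →
        Σ[ Pa⊆Xs ∈ elements (Pa X p) ⊆ˡ Xs ]
          proj ob X∈ ∘ wire M o
          ≈ channel X p ∘ tuple ob (elements (Pa X p)) (λ Y∈ → proj ob (Pa⊆Xs Y∈) ∘ wire M o)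
      proj-wire-nonInput start X∈ p = contradiction (∈-elements⁻ X∈) (x∈∁p⇒x∉p p)
      proj-wire-nonInput (extend q X∉ Pa⊆Xs o) (here refl) p with []=-irrelevant q p
      ... | refl = there ∘′ Pa⊆Xs , ≈.trans (proj-wire-here detM q X∉ Pa⊆Xs o)
        (∘-congˡ (tuple-cong ob (elements (Pa _ p)) λ Y∈ → ≈.sym (proj-wire-there detM q X∉ Pa⊆Xs o (Pa⊆Xs Y∈))))
      proj-wire-nonInput (extend q X∉ Pa⊆Xs o) (there X∈) p with proj-wire-nonInput o X∈ p
      ... | PaX⊆Xs , eq = there ∘′ PaX⊆Xs ,
        ≈.trans (proj-wire-there detM q X∉ Pa⊆Xs o X∈) (≈.trans eq
          (∘-congˡ (tuple-cong ob (elements (Pa _ p)) λ Y∈ → ≈.sym (proj-wire-there detM q X∉ Pa⊆Xs o (PaX⊆Xs Y∈)))))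

      proj-wire-input : ∀ {Xs X} (o : Ordering M Xs) (X∈in : X ∈ˡ elements inputs) →
                        Σ[ X∈ ∈ X ∈ˡ Xs ] proj ob X∈ ∘ wire M o ≈ proj ob X∈in
      proj-wire-input start X∈in = X∈in , identityʳ
      proj-wire-input (extend p X∉ Pa⊆Xs o) X∈in with proj-wire-input o X∈in
      ... | X∈ , eq = there X∈ , ≈.trans (proj-wire-there detM p X∉ Pa⊆Xs o X∈) eq

      -- A complete ordering carries a wire for every variable, each satisfying its mechanism
      -- relative to the others; permuting the wires into standard order gives the solution.
      solve : Σ[ s ∈ ⟦in⟧ ⇒ ⟦all⟧ ] Solution M s
      solve with topologicalOrder M
      ... | Xs , o , all⊆ = s , record
        { deterministic = det-s
        ; fixed         = all-unique V (det-∘ (det-parallel detM) det-s) det-s λ X →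
                            ≈.trans (pullˡ (π-parallel M X)) (component-s X)
        ; on-inputs     = ⨂-unique ob (elements inputs) (det-∘ (det-restrict V inputs) det-s) det-id on-input
        }
        where
          s : ⟦in⟧ ⇒ ⟦all⟧
          s = rewire ob Xs (allFin size) all⊆ ∘ wire M o

          det-s : Deterministic s
          det-s = det-∘ (det-rewire ob all⊆) (det-wire detM o)

          -- Stated for any membership proof, so that it covers those obtained through `Pa⊆Xs` as
          -- well as those from `all⊆`.
          π-s : ∀ {X} (X∈ : X ∈ˡ Xs) → π X ∘ s ≈ proj ob X∈ ∘ wire M o
          π-s {X} X∈ = begin
            π X ∘ s                                   ≈⟨ pullˡ (proj-tuple ob (∈-allFin X)) ⟩
            proj ob (all⊆ (∈-allFin X)) ∘ wire M o    ≡⟨ cong (λ X∈ → proj ob X∈ ∘ wire M o)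
                                                           (unique⇒irrelevant (unique-ordering M o) (all⊆ (∈-allFin X)) X∈) ⟩
            proj ob X∈ ∘ wire M o                     ∎

          component-s : ∀ X → component M X ∘ s ≈ π X ∘ s
          component-s X with X ∈? inputs
          ... | yes _ = ≈.refl
          ... | no X∉in with x∉p⇒x∈∁p X∉in
          ...   | p with proj-wire-nonInput o (all⊆ (∈-allFin X)) p
          ...     | Pa⊆Xs , eq = begin
            (channel X p ∘ restrict (Pa X p)) ∘ s
              ≈⟨ pullʳ (tuple-∘ ob (elements (Pa X p)) det-s) ⟩
            channel X p ∘ tuple ob (elements (Pa X p)) (λ {Y} _ → π Y ∘ s)
              ≈⟨ ∘-congˡ (tuple-cong ob (elements (Pa X p)) λ Y∈ → π-s (Pa⊆Xs Y∈)) ⟩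
            channel X p ∘ tuple ob (elements (Pa X p)) (λ Y∈ → proj ob (Pa⊆Xs Y∈) ∘ wire M o)
              ≈⟨ eq ⟨
            proj ob (all⊆ (∈-allFin X)) ∘ wire M o
              ≈⟨ π-s (all⊆ (∈-allFin X)) ⟨
            π X ∘ s ∎

          on-input : ∀ {X} (X∈ : X ∈ˡ elements inputs) →
                     proj ob X∈ ∘ (restrict inputs ∘ s) ≈ proj ob X∈ ∘ idₘ
          on-input {X} X∈in with proj-wire-input o X∈in
          ... | X∈ , eq = begin
            proj ob X∈in ∘ (restrict inputs ∘ s)   ≈⟨ pullˡ (proj-tuple ob X∈in) ⟩
            π X ∘ s                                ≈⟨ π-s X∈ ⟩
            proj ob X∈ ∘ wire M o                  ≈⟨ eq ⟩
            proj ob X∈in                           ≈⟨ identityʳ ⟨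
            proj ob X∈in ∘ idₘ                     ∎

    -- The model read off from an acyclic deterministic channel.

    module _ {F : ⟦all⟧ ⇒ ⟦all⟧} (detF : Deterministic F) (a : AcyclicChannel {V} F)
             (x : ∀ X → State (ob X)) where
      open AcyclicChannel a

      -- Each mechanism is known only as a factor of the deterministic marginal `π X ∘ F`;
      -- cancelling the split epic `restrict P` transfers determinism to it.
      det-𝖬 : DeterministicModel 𝖬[ a ]
      det-𝖬 X p = det-cancelʳ (restrict-section V x P) (det-restrict V P)
                    (det-resp factor (det-∘ (det-π V X) detF))
        where open LeastFactorisation (mechanism X p)

      -- It suffices to compare marginals: at an input `isInput` makes that of `F` a projection, and
      -- elsewhere `factor` is the required equation.
      parallel-𝖬 : parallel 𝖬[ a ] ≈ F
      parallel-𝖬 = all-unique V (det-parallel det-𝖬) detF λ X → ≈.trans (π-parallel 𝖬[ a ] X) (marginal X)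
        where
          marginal : ∀ X → component 𝖬[ a ] X ≈ π X ∘ F
          marginal X with X ∈? inputs
          ... | yes X∈in = ≈.sym (Equivalence.to (isInput X) X∈in)
          ... | no X∉in  = ≈.sym (LeastFactorisation.factor (mechanism X (x∉p⇒x∈∁p X∉in)))

  -- Transport of models along a deterministic isomorphism.

  module _ (V W : Variables) (ρ : DeterministicIso (Variables.⟦all⟧ V) (Variables.⟦all⟧ W))
           (x : ∀ X → State (Variables.ob V X)) where
    private
      module V = Variables V
      module W = Variables W
      module ρ = DeterministicIso ρ

    det-ρ⁻¹ : Deterministic ρ.from
    det-ρ⁻¹ = det-from ρ.iso ρ.deterministic

    -- States are given for the variables of `V` only; those of `W` are marginals of a joint state
    -- carried across `ρ`.
    states : ∀ X → State (W.ob X)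
    states X = W.π X ∘ (ρ.to ∘ tuple V.ob (allFin V.size) (λ {Y} _ → x Y))

    -- The source of injectivity of `ω`: interventions are compared through `parallel`, which
    -- induction conjugates by `ρ`.
    conjugate-injective : ∀ {f g : V.⟦all⟧ ⇒ V.⟦all⟧} →
                          ρ.to ∘ f ∘ ρ.from ≈ ρ.to ∘ g ∘ ρ.from → f ≈ g
    conjugate-injective {f} {g} p = begin
      f                                              ≈⟨ unconjugate f ⟨
      ρ.from ∘ ((ρ.to ∘ (f ∘ ρ.from)) ∘ ρ.to)        ≈⟨ ∘-congˡ (∘-congʳ p) ⟩
      ρ.from ∘ ((ρ.to ∘ (g ∘ ρ.from)) ∘ ρ.to)        ≈⟨ unconjugate g ⟩
      g                                              ∎
      where
        unconjugate : ∀ f → ρ.from ∘ ((ρ.to ∘ (f ∘ ρ.from)) ∘ ρ.to) ≈ f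
        unconjugate f = ≈.trans (∘-congˡ (pullʳ (cancelʳ ρ.from∘to≈id))) (cancelˡ ρ.from∘to≈id)

    module _ {M : Model V} (detM : DeterministicModel M) (r : Respects V W ρ M) where
      open Respects r

      det-conjugate : Deterministic (ρ.to ∘ parallel M ∘ ρ.from)
      det-conjugate = det-∘ ρ.deterministic (det-∘ (det-parallel detM) det-ρ⁻¹)

      det-inducedModel : DeterministicModel inducedModel
      det-inducedModel = det-𝖬 det-conjugate acyclicChannel states

      parallel-inducedModel : parallel inducedModel ≈ ρ.to ∘ parallel M ∘ ρ.from
      parallel-inducedModel = parallel-𝖬 det-conjugate acyclicChannel states

    module _ {M : Model V} (r : Respects V W ρ M) where
      open Respects r
      private
        module ρⁱⁿ = Iso ρⁱⁿ
        module ρⁿⁱⁿ = Iso ρⁿⁱⁿ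

      restrict-inputs-ρ : W.restrict W.inputs ∘ ρ.to ≈ ρⁱⁿ.to ∘ V.restrict V.inputs
      restrict-inputs-ρ = begin
        W.restrict W.inputs ∘ ρ.to                 ≈⟨ pullˡ fst-⟨⟩ ⟨
        fst ∘ (W.split ∘ ρ.to)                     ≈⟨ ∘-congˡ splits ⟩
        fst ∘ ((ρⁱⁿ.to ⊗₁ ρⁿⁱⁿ.to) ∘ V.split)      ≈⟨ pullˡ fst-⊗ ⟩
        (ρⁱⁿ.to ∘ fst) ∘ V.split                   ≈⟨ pullʳ fst-⟨⟩ ⟩
        ρⁱⁿ.to ∘ V.restrict V.inputs               ∎

      restrict-nonInputs-ρ : W.restrict W.nonInputs ∘ ρ.to ≈ ρⁿⁱⁿ.to ∘ V.restrict V.nonInputs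
      restrict-nonInputs-ρ = begin
        W.restrict W.nonInputs ∘ ρ.to              ≈⟨ pullˡ snd-⟨⟩ ⟨
        snd ∘ (W.split ∘ ρ.to)                     ≈⟨ ∘-congˡ splits ⟩
        snd ∘ ((ρⁱⁿ.to ⊗₁ ρⁿⁱⁿ.to) ∘ V.split)      ≈⟨ pullˡ snd-⊗ ⟩
        (ρⁿⁱⁿ.to ∘ snd) ∘ V.split                  ≈⟨ pullʳ snd-⟨⟩ ⟩
        ρⁿⁱⁿ.to ∘ V.restrict V.nonInputs           ∎

      -- Composed with a restriction of `V`, each `τ t` becomes `ρ` followed by a restriction of
      -- `W`, which is deterministic; the restriction of `V` is then cancelled.
      det-τ : ∀ t → Deterministic (τ t)
      det-τ inᵗ  = det-cancelʳ (restrict-section V x V.inputs) (det-restrict V V.inputs)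
                     (det-resp restrict-inputs-ρ (det-∘ (det-restrict W W.inputs) ρ.deterministic))
      det-τ outᵗ = det-cancelʳ (restrict-section V x V.nonInputs) (det-restrict V V.nonInputs)
                     (det-resp restrict-nonInputs-ρ (det-∘ (det-restrict W W.nonInputs) ρ.deterministic))

      τ⁻¹ : ∀ t → W.⟦ t ⟧ᵗ ⇒ V.⟦ t ⟧ᵗ
      τ⁻¹ inᵗ  = ρⁱⁿ.from
      τ⁻¹ outᵗ = ρⁿⁱⁿ.from

      τ∘τ⁻¹≈id : ∀ t → τ t ∘ τ⁻¹ t ≈ idₘ
      τ∘τ⁻¹≈id inᵗ  = ρⁱⁿ.to∘from≈id
      τ∘τ⁻¹≈id outᵗ = ρⁿⁱⁿ.to∘from≈id

      -- N ranges over the models intervened upon, whereas τ is the one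
      -- obtained from a fixed model M.
      io-commutes : {N : Model V} → DeterministicModel N → (N-resp : Respects V W ρ N) →
                    ρⁿⁱⁿ.to ∘ io N ≈ io (Respects.inducedModel N-resp) ∘ ρⁱⁿ.to
      io-commutes {N} detN N-resp = begin
        ρⁿⁱⁿ.to ∘ io N
          ≈⟨ ∘-congˡ (io-solution detN sol) ⟩
        ρⁿⁱⁿ.to ∘ (V.restrict V.nonInputs ∘ s)
          ≈⟨ pullˡ (≈.sym restrict-nonInputs-ρ) ⟩
        (W.restrict W.nonInputs ∘ ρ.to) ∘ s
          -- Inserting `ρⁱⁿ.from ∘ ρⁱⁿ.to` exposes the transported solution, whose domain is the
          -- inputs of `W`.
          ≈⟨ pullʳ (≈.sym (cancelʳ ρⁱⁿ.from∘to≈id)) ⟩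
        W.restrict W.nonInputs ∘ (((ρ.to ∘ s) ∘ ρⁱⁿ.from) ∘ ρⁱⁿ.to)
          ≈⟨ ∘-assoc ⟨
        (W.restrict W.nonInputs ∘ ((ρ.to ∘ s) ∘ ρⁱⁿ.from)) ∘ ρⁱⁿ.to
          ≈⟨ ∘-congʳ (io-solution (det-inducedModel detN N-resp) transported) ⟨
        io (Respects.inducedModel N-resp) ∘ ρⁱⁿ.to ∎
        where
          s   = proj₁ (solve detN)
          sol = proj₂ (solve detN)
          open Solution sol

          transported : Solution (Respects.inducedModel N-resp) ((ρ.to ∘ s) ∘ ρⁱⁿ.from)
          transported = record
            { deterministic = det-∘ (det-∘ ρ.deterministic deterministic) (det-from ρⁱⁿ (det-τ inᵗ))
            ; fixed = begin
                parallel (Respects.inducedModel N-resp) ∘ ((ρ.to ∘ s) ∘ ρⁱⁿ.from)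
                  ≈⟨ ≈.trans (∘-congʳ (parallel-inducedModel detN N-resp)) (≈.sym ∘-assoc) ⟩
                ((ρ.to ∘ (parallel N ∘ ρ.from)) ∘ (ρ.to ∘ s)) ∘ ρⁱⁿ.from
                  ≈⟨ ∘-congʳ (pullʳ (pullʳ (cancelˡ ρ.from∘to≈id))) ⟩
                (ρ.to ∘ (parallel N ∘ s)) ∘ ρⁱⁿ.from
                  ≈⟨ ∘-congʳ (∘-congˡ fixed) ⟩
                (ρ.to ∘ s) ∘ ρⁱⁿ.from ∎
            ; on-inputs = begin
                W.restrict W.inputs ∘ ((ρ.to ∘ s) ∘ ρⁱⁿ.from)
                  ≈⟨ ≈.trans (≈.sym ∘-assoc) (∘-congʳ (pullˡ restrict-inputs-ρ)) ⟩
                ((ρⁱⁿ.to ∘ V.restrict V.inputs) ∘ s) ∘ ρⁱⁿ.from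
                  ≈⟨ ∘-congʳ (≈.trans (pullʳ on-inputs) identityʳ) ⟩
                ρⁱⁿ.to ∘ ρⁱⁿ.from
                  ≈⟨ ρⁱⁿ.to∘from≈id ⟩
                idₘ ∎
            }

-- The upward abstraction and its bijectivity.

proposition43 :
  ∀ {o ℓ e i : Level} (𝒞 : MarkovCategory o ℓ e) →
  let open MarkovCategory 𝒞
      open CausalModels 𝒞
  in
  HasEnoughStates →
  (V : Variables) (M : Model V) →
  DeterministicModel M →
  (∀ X → State (Variables.ob V X)) →
  (𝓘 : Pred (Intervention M) i) →
  (∀ {σ} → 𝓘 σ → DeterministicModel (M ⟪ σ ⟫)) →
  (trivial∈ : 𝓘 (trivial M)) →
  (W : Variables) →
  (ρ : DeterministicIso (Variables.⟦all⟧ V) (Variables.⟦all⟧ W)) →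
  (respects : RespectsAll V W ρ M 𝓘) →
  let open Induced V W ρ M 𝓘 trivial∈ respects
      𝓛 = ioQueries M 𝓘
      𝓗 = ioQueries ρ[M] ρ̂[𝓘]
  in
  IsUpwardAbstraction 𝓛 𝓗 τ U (λ σ _ → ω σ)
  × Bijective (IOQueries._≈q_ 𝓛) (IOQueries._≈q_ 𝓗) ω
  × (∀ {σ} (s : 𝓘 σ) →
       Iso.to ρⁿⁱⁿ ∘ io (M ⟪ σ ⟫) ≈ io (ρ[M] ⟪ ρ̂ s ⟫) ∘ Iso.to ρⁱⁿ)
  × Iso.to ρⁿⁱⁿ ∘ io M ≈ io ρ[M] ∘ Iso.to ρⁱⁿ
proposition43 𝒞 _ V M detM x 𝓘 detσ trivial∈ W ρ respects =
    record
      { τ-deterministic = det-τ V W ρ x respectsM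
      ; τ-epic          = λ t → section⇒epic (τ∘τ⁻¹≈id V W ρ x respectsM t)
      ; ⨂τ-epic         = λ ts → section⇒epic (⨂-section (τ∘τ⁻¹≈id V W ρ x respectsM) ts)
      ; D-resp          = λ _ _ → _
      ; ω-cong          = λ {σ} {σ′} _ _ → ω-preserves σ σ′
      -- Every element of `ρ̂[𝓘]` carries its own preimage.
      ; ω-surjective    = λ { (_ , σ , s , refl) → (σ , s) , _ , ≈.refl }
      ; commutes        = λ (_ , s) _ → commutes s
      }
  , ( (λ {σ} {σ′} → ω-reflects σ σ′)
    , λ { (_ , σ , s , refl) → (σ , s) , λ {τ′} → ω-preserves τ′ (σ , s) } )
  , commutes
  -- `M ⟪ trivial M ⟫` is definitionally `M`, and likewise `ρ[M] ⟪ ρ̂ trivial∈ ⟫` is `ρ[M]`.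
  , commutes trivial∈
  where
    open MarkovCategory 𝒞
    open CausalModels 𝒞
    open MarkovProperties 𝒞
    open CausalModelProperties 𝒞
    open Induced V W ρ M 𝓘 trivial∈ respects
    module 𝓛 = IOQueries (ioQueries M 𝓘)
    module 𝓗 = IOQueries (ioQueries ρ[M] ρ̂[𝓘])

    commutes : ∀ {σ} (s : 𝓘 σ) →
               Iso.to ρⁿⁱⁿ ∘ io (M ⟪ σ ⟫) ≈ io (ρ[M] ⟪ ρ̂ s ⟫) ∘ Iso.to ρⁱⁿ
    -- `ρ[M] ⟪ ρ̂ s ⟫` computes to the model induced from `M ⟪ σ ⟫`, so no rewriting is required.
    commutes s = io-commutes V W ρ x respectsM (detσ s) (respects s)

    parallel-ω : ∀ {σ} (s : 𝓘 σ) →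
                 parallel (ρ[M] ⟪ ρ̂ s ⟫) ≈ DeterministicIso.to ρ ∘ parallel (M ⟪ σ ⟫) ∘ DeterministicIso.from ρ
    parallel-ω s = parallel-inducedModel V W ρ x (detσ s) (respects s)

    ω-preserves : ∀ σ σ′ → σ 𝓛.≈q σ′ → ω σ 𝓗.≈q ω σ′
    ω-preserves (_ , s) (_ , s′) p =
      ≈.trans (parallel-ω s) (≈.trans (∘-congˡ (∘-congʳ p)) (≈.sym (parallel-ω s′)))

    ω-reflects : ∀ σ σ′ → ω σ 𝓗.≈q ω σ′ → σ 𝓛.≈q σ′
    ω-reflects (_ , s) (_ , s′) p =
      conjugate-injective V W ρ x (≈.trans (≈.sym (parallel-ω s)) (≈.trans p (parallel-ω s′)))
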